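{- Let $B_1,\dots,B_k$ be finite blocks (nonseparable graphs, i.e. connected graphs with no cut vertex), each of which admits an $\alpha$-labeling. Then the disjoint union $B_1\cup B_2\cup\dots\cup B_k$ is odd-graceful.
   Context: For a graph $G$ with $n$ edges, a graceful labeling is an injection $f:V(G)\to\{0,1,\dots,n\}$ such that the edge weights $|f(x)-f(y)|$, $xy\in E(G)$, are exactly $\{1,2,\dots,n\}$. An $\alpha$-labeling is a graceful labeling $f$ for which there is an integer $\lambda$ such that for every edge $xy$ either $f(x)\le\lambda<f(y)$ or $f(y)\le\lambda<f(x)$. A graph $G$ with $n$ edges is odd-graceful if there is an injective map $f:V(G)\to\{0,1,\dots,2n-1\}$ such that the set of edge weights $\{|f(x)-f(y)| : xy\in E(G)\}$ equals $\{1,3,\dots,2n-1\}$.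
   Formalization: Each block is required to have at least two vertices: a single vertex is connected, has no cut vertex and admits an α-labeling, but with n = 0 edges it has no labels 0,…,2n−1, so the claim fails for it. -}

module Defs where

open import Data.Fin.Base using (Fin; toℕ; splitAt)
open import Data.Fin.Properties using (_<?_)
import Data.Integer.Base as ℤ
open import Data.List.Base using (List; allFin; cartesianProduct; filter; length)
open import Data.Nat.Base using (ℕ; _+_; _*_; _≤_; _<_; ∣_-_∣)
open import Data.Product.Base using (∃; ∃-syntax; ∃₂; _×_; _,_; proj₁)
open import Data.Sum.Base using (_⊎_; inj₁; inj₂)
open import Data.Sum.Relation.Binary.Pointwise
  using (Pointwise; inj₁; inj₂; ⊎-symmetric; ⊎-decidable)
open import Data.Vec.Functional using (Vector; foldr)
open import Function.Base using (_on_)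
open import Function.Bundles using (_⇔_)
open import Function.Definitions using (Injective)
open import Level using (0ℓ)
open import Relation.Binary.Core using (Rel)
open import Relation.Binary.Construct.Closure.ReflexiveTransitive using (Star)
open import Relation.Binary.Definitions using (Decidable; Irreflexive; Symmetric)
open import Relation.Binary.PropositionalEquality using (_≡_; _≢_; refl)
open import Relation.Nullary using (¬_)
open import Relation.Nullary.Decidable using (_×-dec_)

record Graph : Set₁ where
  infix 4 _~_ _~?_
  field
    order    : ℕ
    _~_      : Rel (Fin order) 0ℓ
    _~?_     : Decidable _~_
    ~-sym    : Symmetric _~_
    ~-irrefl : Irreflexive _≡_ _~_

  Vertex : Set
  Vertex = Fin order

  -- Each undirected edge is listed once, with its smaller endpoint first.
  edges : List (Vertex × Vertex)
  edges = filter (λ (x , y) → (x <? y) ×-dec (x ~? y))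
                 (cartesianProduct (allFin order) (allFin order))

  size : ℕ
  size = length edges

∅ : Graph
∅ = record
  { order    = 0
  ; _~_      = λ ()
  ; _~?_     = λ ()
  ; ~-sym    = λ { {()} }
  ; ~-irrefl = λ { {()} }
  }

infixr 6 _∪_

_∪_ : Graph → Graph → Graph
G ∪ H = record
  { order    = G.order + H.order
  ; _~_      = _≈_ on splitAt G.order
  ; _~?_     = λ x y → ⊎-decidable G._~?_ H._~?_ (splitAt G.order x) (splitAt G.order y)
  ; ~-sym    = ⊎-symmetric G.~-sym H.~-sym
  ; ~-irrefl = λ { refl → irrefl }
  }
  where
  module G = Graph G
  module H = Graph H

  _≈_ : Rel (G.Vertex ⊎ H.Vertex) 0ℓ
  _≈_ = Pointwise G._~_ H._~_

  irrefl : ∀ {u} → ¬ (u ≈ u)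
  irrefl (inj₁ e) = G.~-irrefl refl e
  irrefl (inj₂ e) = H.~-irrefl refl e

⋃ : ∀ {k} → Vector Graph k → Graph
⋃ = foldr _∪_ ∅

module _ (G : Graph) where
  open Graph G

  Connected : Set
  Connected = ∀ x y → Star _~_ x y

  -- Deleting v increases the number of components: two other vertices are
  -- joined by a walk in G but not in the subgraph induced on V(G) ∖ {v}.
  IsCutVertex : Vertex → Set
  IsCutVertex v = ∃₂ λ (x y : ∃ (_≢ v)) →
    Star _~_ (proj₁ x) (proj₁ y) × ¬ Star (_~_ on proj₁) x y

  -- Nonseparable graphs are nontrivial by convention: a single vertex has an
  -- α-labeling, but without edges it has no labels 0, …, 2n-1 available.
  record IsBlock : Set where
    field
      nontrivial  : 2 ≤ order
      connected   : Connected
      noCutVertex : ∀ v → ¬ IsCutVertex v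

  weight : ∀ {m} → (Vertex → Fin m) → Vertex → Vertex → ℕ
  weight f x y = ∣ toℕ (f x) - toℕ (f y) ∣

  IsEdgeWeight : ∀ {m} → (Vertex → Fin m) → ℕ → Set
  IsEdgeWeight f w = ∃₂ λ x y → x ~ y × w ≡ weight f x y

  record IsGracefulLabeling (f : Vertex → Fin (1 + size)) : Set where
    field
      injective : Injective _≡_ _≡_ f
      weights   : ∀ w → IsEdgeWeight f w ⇔ (1 ≤ w × w ≤ size)

  record IsAlphaLabeling (f : Vertex → Fin (1 + size)) : Set where
    field
      graceful : IsGracefulLabeling f
      boundary : ∃[ λ′ ] ∀ {x y} → x ~ y →
        let a = ℤ.+ toℕ (f x) ; b = ℤ.+ toℕ (f y) in
        (a ℤ.≤ λ′ × λ′ ℤ.< b) ⊎ (b ℤ.≤ λ′ × λ′ ℤ.< a)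

  HasAlphaLabeling : Set
  HasAlphaLabeling = ∃ IsAlphaLabeling

  record IsOddGracefulLabeling (f : Vertex → Fin (2 * size)) : Set where
    field
      injective : Injective _≡_ _≡_ f
      weights   : ∀ w → IsEdgeWeight f w ⇔ (∃[ i ] i < size × w ≡ 1 + 2 * i)

  OddGraceful : Set
  OddGraceful = ∃ IsOddGracefulLabeling

{-# OPTIONS --safe #-}
-- Let B have n ≥ 1 edges and an α-labeling f with boundary value l, and let H
-- have M edges and an odd-graceful labeling h.  On B ∪ H take
--   2f on the vertices of B with f ≤ l,  2(M + f) - 1 on those with f > l,
--   h + 2l + 1 on H.
-- The low labels of B lie in [0, 2l], the labels of H in [2l + 1, 2l + 2M] and
-- the high labels of B in [2l + 2M + 1, 2n + 2M - 1], so the labels are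
-- distinct.  Every edge of B joins a low vertex to a high one, so its weight w
-- becomes 2(M + w) - 1, while the weights of H are unchanged: together they are
-- the odd numbers below 2(n + M).  Iterate over the blocks.
module Submission where

open import Defs
open import Data.Fin.Base as Fin using (Fin; zero; suc; toℕ; fromℕ<; splitAt; join; _↑ˡ_; _↑ʳ_)
open import Data.Fin.Properties
  using ( toℕ<n; toℕ-injective; toℕ-fromℕ<; toℕ-↑ˡ; toℕ-↑ʳ; ↑ˡ-injective; ↑ʳ-injective
        ; splitAt-↑ˡ; splitAt-↑ʳ; splitAt⁻¹-↑ˡ; splitAt⁻¹-↑ʳ; join-splitAt)
import Data.Fin.Properties as Fin
open import Data.Integer.Base using (+_; -[1+_]; +≤+; +<+)
open import Data.List.Base using (List; _++_; map; length; allFin; cartesianProduct)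
open import Data.List.Membership.Propositional using (_∈_)
open import Data.List.Membership.Propositional.Properties
  using (∈-map⁺; ∈-map⁻; ∈-++⁺ˡ; ∈-++⁺ʳ; ∈-++⁻; ∈-filter⁺; ∈-filter⁻; ∈-cartesianProduct⁺; ∈-allFin)
open import Data.List.Membership.Propositional.Properties.WithK using (unique∧set⇒bag)
open import Data.List.Properties using (length-++; length-map)
open import Data.List.Relation.Binary.BagAndSetEquality using (∼bag⇒↭)
open import Data.List.Relation.Binary.Permutation.Propositional.Properties using (↭-length)
open import Data.List.Relation.Unary.Unique.Propositional using (Unique)
import Data.List.Relation.Unary.Unique.Propositional.Properties as Unique
open import Data.Nat.Base
open import Data.Nat.Properties
open import Data.Nat.Tactic.RingSolver using (solve-∀)
open import Data.Product.Base using (∃-syntax; ∃₂; _×_; _,_; proj₁; proj₂)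
open import Data.Product.Properties using (,-injective)
open import Data.Sum.Base using (_⊎_; inj₁; inj₂; [_,_]′)
open import Data.Sum.Relation.Binary.Pointwise using (inj₁; inj₂)
open import Data.Vec.Functional using (Vector)
open import Function.Base using (_∘_)
open import Function.Bundles using (mk⇔; module Equivalence)
open import Function.Definitions using (Injective)
open import Relation.Binary.Construct.Closure.ReflexiveTransitive using (Star; ε; _◅_)
open import Relation.Binary.PropositionalEquality
open import Relation.Nullary using (¬_; yes; no; contradiction)
open import Relation.Nullary.Decidable using (_×-dec_)

-- Edge lists of a graph.

module _ (G : Graph) where
  open Graph G

  edges-unique : Unique edges
  edges-unique = Unique.filter⁺ (λ (x , y) → (x Fin.<? y) ×-dec (x ~? y))
    (Unique.cartesianProduct⁺ (Unique.allFin⁺ order) (Unique.allFin⁺ order))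

  ∈-edges⁺ : ∀ {x y} → x Fin.< y → x ~ y → (x , y) ∈ edges
  ∈-edges⁺ {x} {y} x<y x~y = ∈-filter⁺ (λ (x , y) → (x Fin.<? y) ×-dec (x ~? y))
    (∈-cartesianProduct⁺ (∈-allFin x) (∈-allFin y)) (x<y , x~y)

  ∈-edges⁻ : ∀ {x y} → (x , y) ∈ edges → x Fin.< y × x ~ y
  ∈-edges⁻ e = proj₂ (∈-filter⁻ (λ (x , y) → (x Fin.<? y) ×-dec (x ~? y))
    {xs = cartesianProduct (allFin order) (allFin order)} e)

-- Disjoint unions: edges, size and combined labels.

module _ (G H : Graph) where
  private
    module G = Graph G
    module H = Graph H
    module U = Graph (G ∪ H)

  injˡ : G.Vertex → U.Vertex
  injˡ = _↑ˡ H.order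

  injʳ : H.Vertex → U.Vertex
  injʳ = G.order ↑ʳ_

  ~-injˡ : ∀ {u v} → u G.~ v → injˡ u U.~ injˡ v
  ~-injˡ {u} {v} e
    rewrite splitAt-↑ˡ G.order u H.order | splitAt-↑ˡ G.order v H.order = inj₁ e

  ~-injʳ : ∀ {u v} → u H.~ v → injʳ u U.~ injʳ v
  ~-injʳ {u} {v} e
    rewrite splitAt-↑ʳ G.order H.order u | splitAt-↑ʳ G.order H.order v = inj₂ e

  -- A view of adjacency in the union: matching on it exposes both endpoints as images of vertices
  -- from the same side.
  data UnionEdge : U.Vertex → U.Vertex → Set where
    left  : ∀ {u v} → u G.~ v → UnionEdge (injˡ u) (injˡ v)
    right : ∀ {u v} → u H.~ v → UnionEdge (injʳ u) (injʳ v)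

  unionEdge : ∀ {x y} → x U.~ y → UnionEdge x y
  -- Abstracting `e` along with both splits reduces its type to `Pointwise`, which has no
  -- constructor for ends on different sides.
  unionEdge {x} {y} e with splitAt G.order x in p | splitAt G.order y in q | e
  ... | inj₁ _ | inj₁ _ | inj₁ e′ =
    subst₂ UnionEdge (splitAt⁻¹-↑ˡ p) (splitAt⁻¹-↑ˡ q) (left e′)
  ... | inj₂ _ | inj₂ _ | inj₂ e′ =
    subst₂ UnionEdge (splitAt⁻¹-↑ʳ p) (splitAt⁻¹-↑ʳ q) (right e′)

  injˡ≢injʳ : ∀ {u v} → injˡ u ≢ injʳ v
  injˡ≢injʳ {u} {v} eq
    with trans (sym (splitAt-↑ˡ G.order u H.order))
               (trans (cong (splitAt G.order) eq) (splitAt-↑ʳ G.order H.order v))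
  ... | ()

  private
    edgeˡ : G.Vertex × G.Vertex → U.Vertex × U.Vertex
    edgeˡ (u , v) = injˡ u , injˡ v

    edgeʳ : H.Vertex × H.Vertex → U.Vertex × U.Vertex
    edgeʳ (u , v) = injʳ u , injʳ v

    edges′ : List (U.Vertex × U.Vertex)
    edges′ = map edgeˡ G.edges ++ map edgeʳ H.edges

    edgeˡ-injective : ∀ {e e′} → edgeˡ e ≡ edgeˡ e′ → e ≡ e′
    edgeˡ-injective eq with p , q ← ,-injective eq =
      cong₂ _,_ (↑ˡ-injective H.order _ _ p) (↑ˡ-injective H.order _ _ q)

    edgeʳ-injective : ∀ {e e′} → edgeʳ e ≡ edgeʳ e′ → e ≡ e′
    edgeʳ-injective eq with p , q ← ,-injective eq =
      cong₂ _,_ (↑ʳ-injective G.order _ _ p) (↑ʳ-injective G.order _ _ q)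

    edges′-unique : Unique edges′
    edges′-unique = Unique.++⁺
      (Unique.map⁺ edgeˡ-injective (edges-unique G))
      (Unique.map⁺ edgeʳ-injective (edges-unique H))
      disjoint
      where
      disjoint : ∀ {e} → ¬ (e ∈ map edgeˡ G.edges × e ∈ map edgeʳ H.edges)
      disjoint (p , q) with ∈-map⁻ edgeˡ p | ∈-map⁻ edgeʳ q
      ... | _ , _ , r | _ , _ , s = injˡ≢injʳ (cong proj₁ (trans (sym r) s))

    -- Both injections are strictly increasing, so the smaller end of an edge remains the first one.
    edges⊆ : ∀ {e} → e ∈ U.edges → e ∈ edges′
    edges⊆ e with x<y , x~y ← ∈-edges⁻ (G ∪ H) e with unionEdge x~y
    ... | left {u} {v} u~v = ∈-++⁺ˡ (∈-map⁺ edgeˡ (∈-edges⁺ G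
            (subst₂ _<_ (toℕ-↑ˡ u H.order) (toℕ-↑ˡ v H.order) x<y) u~v))
    ... | right {u} {v} u~v = ∈-++⁺ʳ (map edgeˡ G.edges) (∈-map⁺ edgeʳ (∈-edges⁺ H
            (+-cancelˡ-< G.order _ _
              (subst₂ _<_ (toℕ-↑ʳ G.order u) (toℕ-↑ʳ G.order v) x<y)) u~v))

    edges⊇ : ∀ {e} → e ∈ edges′ → e ∈ U.edges
    edges⊇ e with ∈-++⁻ (map edgeˡ G.edges) e
    edges⊇ e | inj₁ p with ((u , v) , uv∈ , refl) ← ∈-map⁻ edgeˡ p
                      with u<v , u~v ← ∈-edges⁻ G uv∈ =
      ∈-edges⁺ (G ∪ H)
        (subst₂ _<_ (sym (toℕ-↑ˡ u H.order)) (sym (toℕ-↑ˡ v H.order)) u<v)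
        (~-injˡ u~v)
    edges⊇ e | inj₂ p with ((u , v) , uv∈ , refl) ← ∈-map⁻ edgeʳ p
                      with u<v , u~v ← ∈-edges⁻ H uv∈ =
      ∈-edges⁺ (G ∪ H)
        (subst₂ _<_ (sym (toℕ-↑ʳ G.order u)) (sym (toℕ-↑ʳ G.order v))
          (+-monoʳ-< G.order u<v))
        (~-injʳ u~v)

  -- Duplicate-free lists with the same members are permutations of each other, so the lengths agree
  -- without comparing the orders of enumeration.
  size-∪ : U.size ≡ G.size + H.size
  size-∪ = begin
    length U.edges
      ≡⟨ ↭-length (∼bag⇒↭ (unique∧set⇒bag (edges-unique (G ∪ H)) edges′-unique
           (mk⇔ edges⊆ edges⊇))) ⟩
    length edges′
      ≡⟨ length-++ (map edgeˡ G.edges) ⟩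
    length (map edgeˡ G.edges) + length (map edgeʳ H.edges)
      ≡⟨ cong₂ _+_ (length-map edgeˡ G.edges) (length-map edgeʳ H.edges) ⟩
    G.size + H.size ∎
    where open ≡-Reasoning

  module _ (F : G.Vertex → ℕ) (K : H.Vertex → ℕ) where

    ∪-label : U.Vertex → ℕ
    ∪-label = [ F , K ]′ ∘ splitAt G.order

    ∪-label-injˡ : ∀ u → ∪-label (injˡ u) ≡ F u
    ∪-label-injˡ u = cong [ F , K ]′ (splitAt-↑ˡ G.order u H.order)

    ∪-label-injʳ : ∀ v → ∪-label (injʳ v) ≡ K v
    ∪-label-injʳ v = cong [ F , K ]′ (splitAt-↑ʳ G.order H.order v)

    ∪-label-injective : Injective _≡_ _≡_ F → Injective _≡_ _≡_ K →
                        (∀ u v → F u ≢ K v) → Injective _≡_ _≡_ ∪-label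
    ∪-label-injective F-inj K-inj F≢K {x} {y} eq = begin
      x                                   ≡⟨ join-splitAt G.order H.order x ⟨
      join _ H.order (splitAt G.order x)  ≡⟨ cong (join _ _) (⊎-injective (splitAt G.order x) (splitAt G.order y) eq) ⟩
      join _ H.order (splitAt G.order y)  ≡⟨ join-splitAt G.order H.order y ⟩
      y                                   ∎
      where
      open ≡-Reasoning
      ⊎-injective : ∀ s t → [ F , K ]′ s ≡ [ F , K ]′ t → s ≡ t
      ⊎-injective (inj₁ _) (inj₁ _) p = cong inj₁ (F-inj p)
      ⊎-injective (inj₁ u) (inj₂ v) p = contradiction p (F≢K u v)
      ⊎-injective (inj₂ v) (inj₁ u) p = contradiction (sym p) (F≢K u v)
      ⊎-injective (inj₂ _) (inj₂ _) p = cong inj₂ (K-inj p)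

-- Odd-gracefulness from labels in ℕ, and an edge in every block.

module _ (G : Graph) where
  open Graph G

  oddGraceful : (F : Vertex → ℕ) → (∀ x → F x < 2 * size) → Injective _≡_ _≡_ F →
    (∀ {x y} → x ~ y → ∃[ i ] i < size × ∣ F x - F y ∣ ≡ 1 + 2 * i) →
    (∀ {i} → i < size → ∃₂ λ x y → x ~ y × 1 + 2 * i ≡ ∣ F x - F y ∣) →
    OddGraceful G
  oddGraceful F F< F-inj odd all-odd = f , record
    { injective = λ {x} {y} eq → F-inj (trans (sym (f≡F x)) (trans (cong toℕ eq) (f≡F y)))
    ; weights   = λ w → mk⇔
        (λ { (x , y , x~y , refl) → let i , i< , eq = odd x~y in i , i< , trans (weight≡ x y) eq })
        (λ { (i , i< , refl) → let x , y , x~y , eq = all-odd i<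
                               in x , y , x~y , trans eq (sym (weight≡ x y)) })
    }
    where
    f : Vertex → Fin (2 * size)
    f x = fromℕ< (F< x)
    f≡F : ∀ x → toℕ (f x) ≡ F x
    f≡F x = toℕ-fromℕ< (F< x)
    weight≡ : ∀ x y → weight G f x y ≡ ∣ F x - F y ∣
    weight≡ x y = cong₂ ∣_-_∣ (f≡F x) (f≡F y)

  -- A walk between two distinct vertices is not empty. Such an edge forces the boundary of an
  -- α-labeling into the range from 0 to n - 1.
  block-edge : IsBlock G → ∃₂ _~_
  block-edge B = first-edge (IsBlock.connected B x y)
    λ x≡y → 0≢1+n (trans (sym (toℕ-fromℕ< 0<n)) (trans (cong toℕ x≡y) (toℕ-fromℕ< nontrivial)))
    where
    open IsBlock B
    0<n : 0 < order
    0<n = <-trans z<s nontrivial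
    x y : Vertex
    x = fromℕ< 0<n
    y = fromℕ< nontrivial
    first-edge : ∀ {x y} → Star _~_ x y → x ≢ y → ∃₂ _~_
    first-edge ε       x≢x = contradiction refl x≢x
    first-edge (e ◅ _) _   = _ , _ , e

-- The relabeling of a block with boundary `l`, against a graph with `M` edges.

module _ (l M : ℕ) where

  -- Truncated subtraction loses nothing, since `a > l` makes `a` positive.
  spread : ℕ → ℕ
  spread a with a ≤? l
  ... | yes _ = 2 * a
  ... | no  _ = 2 * (M + a) ∸ 1

  -- Writing a high label as `suc a` makes its value visibly odd and free of subtraction; `l ≤ a`
  -- then says `l < suc a`.
  data IsSpread : ℕ → ℕ → Set where
    low  : ∀ {a} → a ≤ l → IsSpread a (2 * a)
    high : ∀ {a} → l ≤ a → IsSpread (suc a) (1 + 2 * (M + a))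

  isSpread : ∀ a → IsSpread a (spread a)
  isSpread a with a ≤? l
  ... | yes a≤l = low a≤l
  isSpread zero    | no a≰l = contradiction z≤n a≰l
  isSpread (suc a) | no a≰l =
    subst (IsSpread (suc a)) (cong pred (lemma M a)) (high (≤-pred (≰⇒> a≰l)))
    where
    lemma : ∀ M a → 2 + 2 * (M + a) ≡ 2 * (M + suc a)
    lemma = solve-∀

  -- Each class is mapped affinely, and parity separates the two: low values are even, high values
  -- odd.
  spread-injective : Injective _≡_ _≡_ spread
  spread-injective {a} {b} = inj (isSpread a) (isSpread b)
    where
    inj : ∀ {a b x y} → IsSpread a x → IsSpread b y → x ≡ y → a ≡ b
    inj (low _)          (low _)          eq = *-cancelˡ-≡ _ _ 2 eq
    inj (low {a} _)      (high {b} _)     eq = contradiction eq (even≢odd a (M + b))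
    inj (high {a} _)     (low {b} _)      eq = contradiction (sym eq) (even≢odd b (M + a))
    inj (high _)         (high _)         eq =
      cong suc (+-cancelˡ-≡ M _ _ (*-cancelˡ-≡ _ _ 2 (suc-injective eq)))

  -- The avoided window from 2l + 1 to 2(M + l) has room for exactly the 2M labels available to the
  -- other graph.
  spread-gap : ∀ a → spread a ≤ 2 * l ⊎ 2 * (M + l) < spread a
  spread-gap a = gap (isSpread a)
    where
    gap : ∀ {a x} → IsSpread a x → x ≤ 2 * l ⊎ 2 * (M + l) < x
    gap (low a≤l)  = inj₁ (*-monoʳ-≤ 2 a≤l)
    gap (high l≤a) = inj₂ (s≤s (*-monoʳ-≤ 2 (+-monoʳ-≤ M l≤a)))

  -- Low values stay below 2n because `l < n`; a high label n would go to 2(n + M) - 1, the last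
  -- admissible value.
  spread-bound : ∀ {n a} → l < n → a ≤ n → spread a < 2 * (n + M)
  spread-bound {n} {a} l<n = bound (isSpread a)
    where
    bound : ∀ {a x} → IsSpread a x → a ≤ n → x < 2 * (n + M)
    bound (low a≤l)      _   = *-monoʳ-< 2 (<-≤-trans (≤-<-trans a≤l l<n) (m≤m+n n M))
    bound (high {a} l≤a) a<n = begin-strict
      1 + 2 * (M + a)  <⟨ ≤-refl ⟩
      2 + 2 * (M + a)  ≡⟨ lemma M a ⟩
      2 * (suc a + M)  ≤⟨ *-monoʳ-≤ 2 (+-monoˡ-≤ M a<n) ⟩
      2 * (n + M)      ∎
      where
      open ≤-Reasoning
      lemma : ∀ M a → 2 + 2 * (M + a) ≡ 2 * (suc a + M)
      lemma = solve-∀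

  -- Here `d` is the old weight less one: 2(M + b) - 1 - 2a = 2(M + (b - a)) - 1.
  spread-weight : ∀ {a b} → a ≤ l → l < b →
    ∃[ d ] ∣ a - b ∣ ≡ 1 + d × ∣ spread a - spread b ∣ ≡ 1 + 2 * (M + d)
  spread-weight {a} {b} a≤l l<b = weights (isSpread a) (isSpread b) a≤l l<b
    where
    weights : ∀ {a b x y} → IsSpread a x → IsSpread b y → a ≤ l → l < b →
      ∃[ d ] ∣ a - b ∣ ≡ 1 + d × ∣ x - y ∣ ≡ 1 + 2 * (M + d)
    weights (high l≤a) _ a<l _ = contradiction (≤-<-trans l≤a a<l) (n≮n _)
    weights _ (low b≤l) _ l<b = contradiction (<-≤-trans l<b b≤l) (n≮n _)
    weights (low {a} _) (high {b} l≤b) a≤l _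
      with d , refl ← m≤n⇒∃[o]m+o≡n (≤-trans a≤l l≤b) = d
        , trans (cong (∣ a -_∣) (sym (+-suc a d))) (∣m-m+n∣≡n a (1 + d))
        , trans (cong (∣ 2 * a -_∣) (lemma M a d)) (∣m-m+n∣≡n (2 * a) _)
      where
      lemma : ∀ M a d → 1 + 2 * (M + (a + d)) ≡ 2 * a + (1 + 2 * (M + d))
      lemma = solve-∀

-- Adding one block to an odd-graceful graph.

module _ (G H : Graph) where
  private
    module G = Graph G
    module H = Graph H

  ∪-oddGraceful : ∃₂ G._~_ → HasAlphaLabeling G → OddGraceful H → OddGraceful (G ∪ H)
  ∪-oddGraceful (x₀ , y₀ , x₀~y₀) (f , α) (h , odd) with IsAlphaLabeling.boundary α
  -- A negative boundary is impossible: one end of the edge carries a natural number at most the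
  -- boundary.
  ... | -[1+ _ ] , bipartite with bipartite x₀~y₀
  ...   | inj₁ (() , _)
  ...   | inj₂ (() , _)
  ∪-oddGraceful (x₀ , y₀ , x₀~y₀) (f , α) (h , odd) | + l , bipartite =
    oddGraceful (G ∪ H) label label-bound
      (∪-label-injective G H F K F-injective K-injective F≢K) weight-odd odd-weight
    where
    open Graph (G ∪ H)
    module f = IsGracefulLabeling (IsAlphaLabeling.graceful α)
    module h = IsOddGracefulLabeling odd
    n M : ℕ
    n = G.size
    M = H.size

    split : ∀ {x y} → x G.~ y → (toℕ (f x) ≤ l × l < toℕ (f y)) ⊎ (toℕ (f y) ≤ l × l < toℕ (f x))
    split e with bipartite e
    ... | inj₁ (+≤+ p , +<+ q) = inj₁ (p , q)
    ... | inj₂ (+≤+ p , +<+ q) = inj₂ (p , q)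

    f≤n : ∀ x → toℕ (f x) ≤ n
    f≤n x = ≤-pred (toℕ<n (f x))

    -- One end of the edge is labeled above `l`, and no label exceeds `n`.
    l<n : l < n
    l<n with split x₀~y₀
    ... | inj₁ (_ , l<b) = <-≤-trans l<b (f≤n y₀)
    ... | inj₂ (_ , l<b) = <-≤-trans l<b (f≤n x₀)

    F : G.Vertex → ℕ
    F u = spread l M (toℕ (f u))

    -- The shift moves the range 0, ..., 2M - 1 onto the window that `spread` avoids.
    K : H.Vertex → ℕ
    K v = 1 + 2 * l + toℕ (h v)

    K≤ : ∀ v → K v ≤ 2 * (M + l)
    K≤ v = begin
      1 + 2 * l + toℕ (h v)    ≡⟨ lemma l (toℕ (h v)) ⟩
      suc (toℕ (h v)) + 2 * l  ≤⟨ +-monoˡ-≤ (2 * l) (toℕ<n (h v)) ⟩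
      2 * M + 2 * l            ≡⟨ *-distribˡ-+ 2 M l ⟨
      2 * (M + l)              ∎
      where
      open ≤-Reasoning
      lemma : ∀ l k → 1 + 2 * l + k ≡ suc k + 2 * l
      lemma = solve-∀

    F-injective : Injective _≡_ _≡_ F
    F-injective = f.injective ∘ toℕ-injective ∘ spread-injective l M

    K-injective : Injective _≡_ _≡_ K
    K-injective = h.injective ∘ toℕ-injective ∘ +-cancelˡ-≡ (1 + 2 * l) _ _

    F≢K : ∀ u v → F u ≢ K v
    F≢K u v with spread-gap l M (toℕ (f u))
    ... | inj₁ F≤ = <⇒≢ (≤-<-trans F≤ (m≤m+n (1 + 2 * l) _))
    ... | inj₂ F> = >⇒≢ (≤-<-trans (K≤ v) F>)

    label : Vertex → ℕ
    label = ∪-label G H F K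

    label-bound : ∀ x → label x < 2 * size
    label-bound x rewrite size-∪ G H with splitAt G.order x
    ... | inj₁ u = spread-bound l M l<n (f≤n u)
    ... | inj₂ v = ≤-<-trans (K≤ v)
      (*-monoʳ-< 2 (subst (_< n + M) (+-comm l M) (+-monoˡ-< M l<n)))

    label-weightˡ : ∀ u v → ∣ label (injˡ G H u) - label (injˡ G H v) ∣ ≡ ∣ F u - F v ∣
    label-weightˡ u v = cong₂ ∣_-_∣ (∪-label-injˡ G H F K u) (∪-label-injˡ G H F K v)

    label-weightʳ : ∀ u v → ∣ label (injʳ G H u) - label (injʳ G H v) ∣ ≡ weight H h u v
    label-weightʳ u v =
      trans (cong₂ ∣_-_∣ (∪-label-injʳ G H F K u) (∪-label-injʳ G H F K v))
            (∣m+n-m+o∣≡∣n-o∣ (1 + 2 * l) _ _)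

    F-weight : ∀ {u v} → u G.~ v → ∃[ d ] weight G f u v ≡ 1 + d × ∣ F u - F v ∣ ≡ 1 + 2 * (M + d)
    F-weight {u} {v} e with split e
    ... | inj₁ (p , q) = spread-weight l M p q
    ... | inj₂ (p , q) =
      let d , r , s = spread-weight l M p q
      in d , trans (∣-∣-comm (toℕ (f u)) _) r , trans (∣-∣-comm (F u) _) s

    -- Block edges receive the indices `M + d` with `d < n`, while the other edges keep indices
    -- below `M`.
    weight-odd : ∀ {x y} → x ~ y → ∃[ i ] i < size × ∣ label x - label y ∣ ≡ 1 + 2 * i
    weight-odd e rewrite size-∪ G H with unionEdge G H e
    ... | left {u} {v} e′ =
      let d , r , s = F-weight e′
          _ , 1+d≤n = Equivalence.to (f.weights (1 + d)) (u , v , e′ , sym r)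
      in M + d , subst (M + d <_) (+-comm M n) (+-monoʳ-< M 1+d≤n) , trans (label-weightˡ u v) s
    ... | right {u} {v} e′ =
      let i , i<M , eq = Equivalence.to (h.weights _) (u , v , e′ , refl)
      in i , <-≤-trans i<M (m≤n+m M n) , trans (label-weightʳ u v) eq

    odd-weight : ∀ {i} → i < size → ∃₂ λ x y → x ~ y × 1 + 2 * i ≡ ∣ label x - label y ∣
    odd-weight {i} i<N rewrite size-∪ G H with i <? M
    ... | yes i<M =
      let u , v , e , eq = Equivalence.from (h.weights _) (i , i<M , refl)
      in _ , _ , ~-injʳ G H e , trans eq (sym (label-weightʳ u v))
    -- The index `M + d` comes from the block edge of weight `1 + d`.
    ... | no i≮M with d , refl ← m≤n⇒∃[o]m+o≡n (≮⇒≥ i≮M) =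
      let d<n = +-cancelˡ-< M d n (subst (M + d <_) (+-comm n M) i<N)
          u , v , e , 1+d≡w = Equivalence.from (f.weights (1 + d)) (z<s , d<n)
          -- `F-weight` yields its own `d′`, identified with `d` through the weight of `e` under
          -- `f`.
          d′ , w≡1+d′ , eq = F-weight e
          d≡d′ = suc-injective (trans 1+d≡w w≡1+d′)
      in _ , _ , ~-injˡ G H e
         , trans (cong (λ d → 1 + 2 * (M + d)) d≡d′) (trans (sym eq) (sym (label-weightˡ u v)))

-- Induction on the number of blocks.

∅-oddGraceful : OddGraceful ∅
-- The label set `Fin 0` is empty, but there is no vertex to label and no weight to realize.
∅-oddGraceful = (λ ()) , record
  { injective = λ { {()} }
  ; weights   = λ _ → mk⇔ (λ { (() , _) }) (λ { (_ , () , _) })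
  }

theorem3 : ∀ (k : ℕ) (B : Vector Graph k) →
    (∀ i → IsBlock (B i)) →
    (∀ i → HasAlphaLabeling (B i)) →
    OddGraceful (⋃ B)
theorem3 zero    B block α = ∅-oddGraceful
theorem3 (suc k) B block α =
  ∪-oddGraceful (B zero) (⋃ (B ∘ suc)) (block-edge (B zero) (block zero)) (α zero)
    (theorem3 k (B ∘ suc) (block ∘ suc) (α ∘ suc))
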